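{- For every $p\in[0,1]$ and every $\varepsilon>0$ there exists an instance $\mathcal{I}=(G,\{r_i,F_i\}_{i\in[N]})$ of the online matching problem with reusable resources, with $F_i=\mathrm{Geometric}(p_i)$ for all $i\in[N]$ and $\min_{i\in[N]}p_i=p$, such that $$\frac{\mathsf{Greedy}(\mathcal{I})}{\mathsf{OPT}(\mathcal{I})}\ \le\ \frac{1+p}{2}+\varepsilon.$$
   Context: Model. An instance $\mathcal{I}=(G,\{r_i,F_i\}_{i\in[N]})$ consists of a bipartite graph $G$ with $N$ offline vertices ("resources", indexed by $[N]=\{1,\dots,N\}$) and $T$ online vertices ("requests", indexed by $1,\dots,T$), rewards $0\le r_1\le\dots\le r_N$, and for each resource $i$ a probability distribution $F_i$ of usage durations, supported on $\{1,2,3,\dots\}\cup\{+\infty\}$ ($+\infty$ meaning the resource never returns). Let $N_t\subseteq[N]$ be the set of resources adjacent to request $t$. At each time $t=1,\dots,T$ request $t$ arrives, $N_t$ is revealed, and a policy irrevocably chooses $A_t\in(N_t\cap I_t)\cup\{0\}$, where $I_t\subseteq[N]$ is the set of resources available at time $t$ (all resources are available at time 1) and $0$ means no match. If $A_t=i\in[N]$, the policy earns reward $r_i$, and resource $i$ becomes unavailable for a random duration $D_{it}\ge1$ drawn from $F_i$, independently for every match; it becomes available again at the start of time $t+D_{it}$ and can be matched immediately. $\mathrm{Geometric}(q)$, for $q\in[0,1]$, is the distribution on $\{1,2,\dots\}$ with $\Pr(D=k)=(1-q)^{k-1}q$; for $q=0$ the duration is $+\infty$ almost surely. The greedy policy chooses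 $A_t=\max\big((N_t\cap I_t)\cup\{0\}\big)$, i.e. the available adjacent resource of highest index (hence highest reward). $\mathsf{Greedy}(\mathcal{I})$ is its expected total reward. $\mathsf{OPT}(\mathcal{I})$ is the expected total reward of an optimal clairvoyant policy: a policy of maximum expected total reward among all policies that know the whole instance $\mathcal{I}$ (in particular the entire graph $G$) in advance but do not know the realizations of the usage durations ahead of time (decisions at time $t$ depend only on what has been observed so far). The instance in the claim is understood to have $\mathsf{OPT}(\mathcal{I})>0$. -}

module Defs where

open import Algebra.Properties.CommutativeSemigroup using (interchange)
open import Algebra.Bundles using (module CommutativeMonoid)
open import Data.Bool using (true; false)
open import Data.Fin as Fin using (Fin; toℕ)
open import Data.Fin.Subset using (Subset; _∈_; _∩_)
open import Data.List using (List; []; _∷_; length; allFin)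
open import Data.Maybe as Maybe using (Maybe; just; nothing; maybe′)
open import Data.Nat as ℕ using (ℕ; zero; suc)
import Data.Nat.Properties as ℕₚ
open import Data.Product using (∃; _×_; _,_)
open import Data.Rational as ℚ using (ℚ; 0ℚ; 1ℚ; ½)
import Data.Rational.Properties as ℚₚ
open import Data.Vec as Vec using ([]; _∷_; here; there)
open import Data.Vec.Functional using (updateAt)
open import Function using (const)
open import Relation.Binary.PropositionalEquality using (_≡_; refl; sym; trans; cong; cong₂; subst)

private
  +-interchange = interchange
    (CommutativeMonoid.commutativeSemigroup ℚₚ.+-0-commutativeMonoid)

  split : ∀ a b → a ≡ (a ℚ.- b) ℚ.+ b
  split a b = sym (trans (ℚₚ.+-assoc a (ℚ.- b) b)
    (trans (cong (a ℚ.+_) (ℚₚ.+-inverseˡ b)) (ℚₚ.+-identityʳ a)))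

  telescope : ∀ a b c → a ℚ.- c ≡ (a ℚ.- b) ℚ.+ (b ℚ.- c)
  telescope a b c = trans (cong (ℚ._- c) (split a b)) (ℚₚ.+-assoc (a ℚ.- b) b (ℚ.- c))

  dist-+ : ∀ a b c d → (a ℚ.+ b) ℚ.- (c ℚ.+ d) ≡ (a ℚ.- c) ℚ.+ (b ℚ.- d)
  dist-+ a b c d = trans (cong ((a ℚ.+ b) ℚ.+_) (ℚₚ.neg-distrib-+ c d))
    (+-interchange a b (ℚ.- c) (ℚ.- d))

  *-distribˡ-- : ∀ a b c → a ℚ.* (b ℚ.- c) ≡ a ℚ.* b ℚ.- a ℚ.* c
  *-distribˡ-- a b c = trans (ℚₚ.*-distribˡ-+ a b (ℚ.- c))
    (cong (a ℚ.* b ℚ.+_) (sym (ℚₚ.neg-distribʳ-* a c)))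

  dist-* : ∀ a b c d → a ℚ.* b ℚ.- c ℚ.* d ≡ a ℚ.* (b ℚ.- d) ℚ.+ d ℚ.* (a ℚ.- c)
  dist-* a b c d = trans (telescope (a ℚ.* b) (a ℚ.* d) (c ℚ.* d))
    (cong₂ ℚ._+_ (sym (*-distribˡ-- a b d))
      (trans (cong₂ ℚ._-_ (ℚₚ.*-comm a d) (ℚₚ.*-comm c d)) (sym (*-distribˡ-- d a c))))

  halves : ∀ ε → ½ ℚ.* ε ℚ.+ ½ ℚ.* ε ≡ ε
  halves ε = trans (sym (ℚₚ.*-distribʳ-+ ε ½ ½)) (ℚₚ.*-identityˡ ε)

  0<* : ∀ {p q} → 0ℚ ℚ.< p → 0ℚ ℚ.< q → 0ℚ ℚ.< p ℚ.* q
  0<* {p} {q} 0<p 0<q =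
    ℚₚ.positive⁻¹ (p ℚ.* q)
      {{ℚₚ.pos*pos⇒pos p {{ℚ.positive 0<p}} q {{ℚ.positive 0<q}}}}

  0<½* : ∀ {ε} → 0ℚ ℚ.< ε → 0ℚ ℚ.< ½ ℚ.* ε
  0<½* = 0<* (ℚₚ.positive⁻¹ ½)

  *-mono-≤ : ∀ {p q r s} → 0ℚ ℚ.≤ q → 0ℚ ℚ.≤ r → p ℚ.≤ q → r ℚ.≤ s →
             p ℚ.* r ℚ.≤ q ℚ.* s
  *-mono-≤ {p} {q} {r} {s} 0≤q 0≤r p≤q r≤s =
    ℚₚ.≤-trans (ℚₚ.*-monoʳ-≤-nonNeg r {{ℚ.nonNegative 0≤r}} p≤q)
               (ℚₚ.*-monoˡ-≤-nonNeg q {{ℚ.nonNegative 0≤q}} r≤s)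

invℚ : (q : ℚ) → 0ℚ ℚ.< q → ℚ
invℚ q 0<q = ℚ.1/_ q {{ℚ.>-nonZero 0<q}}

private
  invℚ-pos : ∀ q (0<q : 0ℚ ℚ.< q) → 0ℚ ℚ.< invℚ q 0<q
  invℚ-pos q 0<q =
    ℚₚ.positive⁻¹ (invℚ q 0<q) {{ℚₚ.1/pos⇒pos q {{ℚ.positive 0<q}}}}

  invℚ-inverseʳ : ∀ q (0<q : 0ℚ ℚ.< q) → q ℚ.* invℚ q 0<q ≡ 1ℚ
  invℚ-inverseʳ q 0<q = ℚₚ.*-inverseʳ q {{ℚ.>-nonZero 0<q}}

  invℚ-inverseˡ : ∀ q (0<q : 0ℚ ℚ.< q) → invℚ q 0<q ℚ.* q ≡ 1ℚ
  invℚ-inverseˡ q 0<q = ℚₚ.*-inverseˡ q {{ℚ.>-nonZero 0<q}}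

  invℚ-antimono : ∀ p q (0<p : 0ℚ ℚ.< p) (0<q : 0ℚ ℚ.< q) → p ℚ.≤ q →
                  invℚ q 0<q ℚ.≤ invℚ p 0<p
  invℚ-antimono p q 0<p 0<q p≤q = subst₂′ left right
    (ℚₚ.*-monoˡ-≤-nonNeg (q⁻¹ ℚ.* p⁻¹)
      {{ℚ.nonNegative (ℚₚ.<⇒≤ (0<* (invℚ-pos q 0<q) (invℚ-pos p 0<p)))}} p≤q)
    where
    p⁻¹ = invℚ p 0<p
    q⁻¹ = invℚ q 0<q
    subst₂′ : ∀ {a b c d} → a ≡ c → b ≡ d → a ℚ.≤ b → c ℚ.≤ d
    subst₂′ refl refl h = h
    left : (q⁻¹ ℚ.* p⁻¹) ℚ.* p ≡ q⁻¹
    left = trans (ℚₚ.*-assoc q⁻¹ p⁻¹ p)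
           (trans (cong (q⁻¹ ℚ.*_) (invℚ-inverseˡ p 0<p)) (ℚₚ.*-identityʳ q⁻¹))
    right : (q⁻¹ ℚ.* p⁻¹) ℚ.* q ≡ p⁻¹
    right = trans (cong (ℚ._* q) (ℚₚ.*-comm q⁻¹ p⁻¹)) (trans (ℚₚ.*-assoc p⁻¹ q⁻¹ q)
            (trans (cong (p⁻¹ ℚ.*_) (invℚ-inverseˡ q 0<q)) (ℚₚ.*-identityʳ p⁻¹)))

  shrink : ∀ {ε B} → 0ℚ ℚ.< ε → 0ℚ ℚ.< B → ∃ λ δ → 0ℚ ℚ.< δ × B ℚ.* δ ≡ ε
  shrink {ε} {B} 0<ε 0<B =
    invℚ B 0<B ℚ.* ε , 0<* (invℚ-pos B 0<B) 0<ε ,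
    trans (sym (ℚₚ.*-assoc B (invℚ B 0<B) ε))
      (trans (cong (ℚ._* ε) (invℚ-inverseʳ B 0<B)) (ℚₚ.*-identityˡ ε))

  invℚ-dist : ∀ a b (0<a : 0ℚ ℚ.< a) (0<b : 0ℚ ℚ.< b) →
              invℚ a 0<a ℚ.- invℚ b 0<b ≡ (invℚ a 0<a ℚ.* invℚ b 0<b) ℚ.* (b ℚ.- a)
  invℚ-dist a b 0<a 0<b = sym (trans
    (*-distribˡ-- (a⁻¹ ℚ.* b⁻¹) b a)
    (cong₂ ℚ._-_
      (trans (ℚₚ.*-assoc a⁻¹ b⁻¹ b)
        (trans (cong (a⁻¹ ℚ.*_) (invℚ-inverseˡ b 0<b)) (ℚₚ.*-identityʳ a⁻¹)))
      (trans (cong (ℚ._* a) (ℚₚ.*-comm a⁻¹ b⁻¹)) (trans (ℚₚ.*-assoc b⁻¹ a⁻¹ a)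
        (trans (cong (b⁻¹ ℚ.*_) (invℚ-inverseˡ a 0<a)) (ℚₚ.*-identityʳ b⁻¹))))))
    where
    a⁻¹ = invℚ a 0<a
    b⁻¹ = invℚ b 0<b

-- Representatives of real numbers; equality of the reals they represent is _≃_.

Cauchy : (ℕ → ℚ) → Set
Cauchy s = ∀ ε → 0ℚ ℚ.< ε →
  ∃ λ M → ∀ m n → M ℕ.≤ m → M ℕ.≤ n → ℚ.∣ s m ℚ.- s n ∣ ℚ.≤ ε

record ℝ : Set where
  constructor mkℝ
  field
    seq    : ℕ → ℚ
    cauchy : Cauchy seq

open ℝ public

infix 4 _≃_ _≤_ _<_

_≃_ : ℝ → ℝ → Set
x ≃ y = ∀ ε → 0ℚ ℚ.< ε →
  ∃ λ M → ∀ n → M ℕ.≤ n → ℚ.∣ seq x n ℚ.- seq y n ∣ ℚ.≤ ε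

_≤_ : ℝ → ℝ → Set
x ≤ y = ∀ ε → 0ℚ ℚ.< ε →
  ∃ λ M → ∀ n → M ℕ.≤ n → seq x n ℚ.≤ seq y n ℚ.+ ε

_<_ : ℝ → ℝ → Set
x < y = ∃ λ δ → 0ℚ ℚ.< δ ×
  ∃ λ M → ∀ n → M ℕ.≤ n → seq x n ℚ.+ δ ℚ.≤ seq y n

fromℚ : ℚ → ℝ
fromℚ q = mkℝ (λ _ → q) λ ε 0<ε → 0 , λ _ _ _ _ →
  ℚₚ.≤-trans (ℚₚ.≤-reflexive (cong ℚ.∣_∣ (ℚₚ.+-inverseʳ q))) (ℚₚ.<⇒≤ 0<ε)

0ℝ 1ℝ ½ℝ : ℝ
0ℝ = fromℚ 0ℚ
1ℝ = fromℚ 1ℚ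
½ℝ = fromℚ ½

infixl 6 _+_ _-_
infixl 7 _*_
infix  8 -_
infixr 9 _^_

opaque
  _+_ : ℝ → ℝ → ℝ
  x + y = mkℝ (λ n → seq x n ℚ.+ seq y n) proof
    where
    proof : Cauchy (λ n → seq x n ℚ.+ seq y n)
    proof ε 0<ε with cauchy x (½ ℚ.* ε) (0<½* 0<ε) | cauchy y (½ ℚ.* ε) (0<½* 0<ε)
    ... | M , hx | K , hy = M ℕ.⊔ K , λ m n p q → begin
      ℚ.∣ (seq x m ℚ.+ seq y m) ℚ.- (seq x n ℚ.+ seq y n) ∣
        ≡⟨ cong ℚ.∣_∣ (dist-+ (seq x m) (seq y m) (seq x n) (seq y n)) ⟩
      ℚ.∣ (seq x m ℚ.- seq x n) ℚ.+ (seq y m ℚ.- seq y n) ∣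
        ≤⟨ ℚₚ.∣p+q∣≤∣p∣+∣q∣ (seq x m ℚ.- seq x n) (seq y m ℚ.- seq y n) ⟩
      ℚ.∣ seq x m ℚ.- seq x n ∣ ℚ.+ ℚ.∣ seq y m ℚ.- seq y n ∣
        ≤⟨ ℚₚ.+-mono-≤ (hx m n (ℕₚ.m⊔n≤o⇒m≤o M K p) (ℕₚ.m⊔n≤o⇒m≤o M K q))
                       (hy m n (ℕₚ.m⊔n≤o⇒n≤o M K p) (ℕₚ.m⊔n≤o⇒n≤o M K q)) ⟩
      ½ ℚ.* ε ℚ.+ ½ ℚ.* ε
        ≡⟨ halves ε ⟩
      ε ∎
      where open ℚₚ.≤-Reasoning

  -_ : ℝ → ℝ
  - x = mkℝ (λ n → ℚ.- seq x n) proof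
    where
    proof : Cauchy (λ n → ℚ.- seq x n)
    proof ε 0<ε with cauchy x ε 0<ε
    ... | M , hx = M , λ m n p q →
      subst (ℚ._≤ ε)
        (trans (sym (ℚₚ.∣-p∣≡∣p∣ (seq x m ℚ.- seq x n)))
               (cong ℚ.∣_∣ (ℚₚ.neg-distrib-+ (seq x m) (ℚ.- seq x n))))
        (hx m n p q)

_-_ : ℝ → ℝ → ℝ
x - y = x + (- y)

private
  eventuallyBounded : ∀ x → ∃ λ B → 0ℚ ℚ.< B ×
    ∃ λ M → ∀ n → M ℕ.≤ n → ℚ.∣ seq x n ∣ ℚ.≤ B
  eventuallyBounded x with cauchy x 1ℚ (ℚₚ.positive⁻¹ 1ℚ)
  ... | M , hx = 1ℚ ℚ.+ ℚ.∣ seq x M ∣ ,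
    ℚₚ.+-mono-<-≤ (ℚₚ.positive⁻¹ 1ℚ) (ℚₚ.0≤∣p∣ (seq x M)) ,
    M , λ n p → begin
    ℚ.∣ seq x n ∣
      ≡⟨ cong ℚ.∣_∣ (split (seq x n) (seq x M)) ⟩
    ℚ.∣ (seq x n ℚ.- seq x M) ℚ.+ seq x M ∣
      ≤⟨ ℚₚ.∣p+q∣≤∣p∣+∣q∣ (seq x n ℚ.- seq x M) (seq x M) ⟩
    ℚ.∣ seq x n ℚ.- seq x M ∣ ℚ.+ ℚ.∣ seq x M ∣
      ≤⟨ ℚₚ.+-monoˡ-≤ ℚ.∣ seq x M ∣ (hx n M p ℕₚ.≤-refl) ⟩
    1ℚ ℚ.+ ℚ.∣ seq x M ∣ ∎
    where open ℚₚ.≤-Reasoning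

opaque
  _*_ : ℝ → ℝ → ℝ
  x * y = mkℝ (λ n → seq x n ℚ.* seq y n) proof
    where
    proof : Cauchy (λ n → seq x n ℚ.* seq y n)
    proof ε 0<ε with eventuallyBounded x | eventuallyBounded y
    ... | A , 0<A , M₁ , bx | B , 0<B , M₂ , by
      with shrink (0<½* 0<ε) 0<A | shrink (0<½* 0<ε) 0<B
    ... | α , 0<α , Aα≡ | β , 0<β , Bβ≡
      with cauchy y α 0<α | cauchy x β 0<β
    ... | M₃ , hy | M₄ , hx = (M₁ ℕ.⊔ M₂) ℕ.⊔ (M₃ ℕ.⊔ M₄) , λ m n p q →
      let p₁₂ = ℕₚ.m⊔n≤o⇒m≤o (M₁ ℕ.⊔ M₂) (M₃ ℕ.⊔ M₄) p
          p₃₄ = ℕₚ.m⊔n≤o⇒n≤o (M₁ ℕ.⊔ M₂) (M₃ ℕ.⊔ M₄) p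
          q₁₂ = ℕₚ.m⊔n≤o⇒m≤o (M₁ ℕ.⊔ M₂) (M₃ ℕ.⊔ M₄) q
          q₃₄ = ℕₚ.m⊔n≤o⇒n≤o (M₁ ℕ.⊔ M₂) (M₃ ℕ.⊔ M₄) q
          a = seq x m ; b = seq y m ; c = seq x n ; d = seq y n
      in begin
      ℚ.∣ a ℚ.* b ℚ.- c ℚ.* d ∣
        ≡⟨ cong ℚ.∣_∣ (dist-* a b c d) ⟩
      ℚ.∣ a ℚ.* (b ℚ.- d) ℚ.+ d ℚ.* (a ℚ.- c) ∣
        ≤⟨ ℚₚ.∣p+q∣≤∣p∣+∣q∣ (a ℚ.* (b ℚ.- d)) (d ℚ.* (a ℚ.- c)) ⟩
      ℚ.∣ a ℚ.* (b ℚ.- d) ∣ ℚ.+ ℚ.∣ d ℚ.* (a ℚ.- c) ∣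
        ≡⟨ cong₂ ℚ._+_ (ℚₚ.∣p*q∣≡∣p∣*∣q∣ a (b ℚ.- d)) (ℚₚ.∣p*q∣≡∣p∣*∣q∣ d (a ℚ.- c)) ⟩
      ℚ.∣ a ∣ ℚ.* ℚ.∣ b ℚ.- d ∣ ℚ.+ ℚ.∣ d ∣ ℚ.* ℚ.∣ a ℚ.- c ∣
        ≤⟨ ℚₚ.+-mono-≤
             (*-mono-≤ (ℚₚ.<⇒≤ 0<A) (ℚₚ.0≤∣p∣ (b ℚ.- d))
                (bx m (ℕₚ.m⊔n≤o⇒m≤o M₁ M₂ p₁₂))
                (hy m n (ℕₚ.m⊔n≤o⇒m≤o M₃ M₄ p₃₄) (ℕₚ.m⊔n≤o⇒m≤o M₃ M₄ q₃₄)))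
             (*-mono-≤ (ℚₚ.<⇒≤ 0<B) (ℚₚ.0≤∣p∣ (a ℚ.- c))
                (by n (ℕₚ.m⊔n≤o⇒n≤o M₁ M₂ q₁₂))
                (hx m n (ℕₚ.m⊔n≤o⇒n≤o M₃ M₄ p₃₄) (ℕₚ.m⊔n≤o⇒n≤o M₃ M₄ q₃₄))) ⟩
      A ℚ.* α ℚ.+ B ℚ.* β
        ≡⟨ cong₂ ℚ._+_ Aα≡ Bβ≡ ⟩
      ½ ℚ.* ε ℚ.+ ½ ℚ.* ε
        ≡⟨ halves ε ⟩
      ε ∎
      where open ℚₚ.≤-Reasoning

_^_ : ℝ → ℕ → ℝ
x ^ zero  = 1ℝ
x ^ suc n = x * x ^ n

-- If seq x n ≥ δ > 0 for n ≥ M, then clamping the sequence from below at δ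
-- alters only the terms before M, so x ⁻¹⟨ 0<x ⟩ represents 1/x.
infix 8 _⁻¹⟨_⟩

opaque
  _⁻¹⟨_⟩ : (x : ℝ) → 0ℝ < x → ℝ
  x ⁻¹⟨ δ , 0<δ , M , x≥δ ⟩ = mkℝ (λ n → invℚ (clamped n) (clamped>0 n)) proof
    where
    clamped : ℕ → ℚ
    clamped n = seq x n ℚ.⊔ δ

    clamped>0 : ∀ n → 0ℚ ℚ.< clamped n
    clamped>0 n = ℚₚ.<-≤-trans 0<δ (ℚₚ.p≤q⊔p (seq x n) δ)

    clamped≡ : ∀ n → M ℕ.≤ n → clamped n ≡ seq x n
    clamped≡ n p = ℚₚ.p≥q⇒p⊔q≡p
      (subst (ℚ._≤ seq x n) (ℚₚ.+-identityˡ δ) (x≥δ n p))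

    C : ℚ
    C = invℚ δ 0<δ

    0<C : 0ℚ ℚ.< C
    0<C = invℚ-pos δ 0<δ

    proof : Cauchy (λ n → invℚ (clamped n) (clamped>0 n))
    proof ε 0<ε with shrink 0<ε (0<* 0<C 0<C)
    ... | η , 0<η , CCη≡ε with cauchy x η 0<η
    ... | K , hx = M ℕ.⊔ K , λ m n p q →
      let a   = clamped m ; b = clamped n
          a⁻¹ = invℚ a (clamped>0 m) ; b⁻¹ = invℚ b (clamped>0 n)
          0≤a⁻¹ = ℚₚ.<⇒≤ (invℚ-pos a (clamped>0 m))
          0≤b⁻¹ = ℚₚ.<⇒≤ (invℚ-pos b (clamped>0 n))
      in begin
      ℚ.∣ a⁻¹ ℚ.- b⁻¹ ∣
        ≡⟨ cong ℚ.∣_∣ (invℚ-dist a b (clamped>0 m) (clamped>0 n)) ⟩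
      ℚ.∣ (a⁻¹ ℚ.* b⁻¹) ℚ.* (b ℚ.- a) ∣
        ≡⟨ ℚₚ.∣p*q∣≡∣p∣*∣q∣ (a⁻¹ ℚ.* b⁻¹) (b ℚ.- a) ⟩
      ℚ.∣ a⁻¹ ℚ.* b⁻¹ ∣ ℚ.* ℚ.∣ b ℚ.- a ∣
        ≡⟨ cong₂ ℚ._*_
             (ℚₚ.0≤p⇒∣p∣≡p (ℚₚ.<⇒≤ (0<* (invℚ-pos a (clamped>0 m)) (invℚ-pos b (clamped>0 n)))))
             (cong₂ (λ u v → ℚ.∣ u ℚ.- v ∣)
                (clamped≡ n (ℕₚ.m⊔n≤o⇒m≤o M K q)) (clamped≡ m (ℕₚ.m⊔n≤o⇒m≤o M K p))) ⟩
      (a⁻¹ ℚ.* b⁻¹) ℚ.* ℚ.∣ seq x n ℚ.- seq x m ∣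
        ≤⟨ *-mono-≤ (ℚₚ.<⇒≤ (0<* 0<C 0<C)) (ℚₚ.0≤∣p∣ (seq x n ℚ.- seq x m))
             (*-mono-≤ (ℚₚ.<⇒≤ 0<C) 0≤b⁻¹
                (invℚ-antimono δ a 0<δ (clamped>0 m) (ℚₚ.p≤q⊔p (seq x m) δ))
                (invℚ-antimono δ b 0<δ (clamped>0 n) (ℚₚ.p≤q⊔p (seq x n) δ)))
             (hx n m (ℕₚ.m⊔n≤o⇒n≤o M K q) (ℕₚ.m⊔n≤o⇒n≤o M K p)) ⟩
      (C ℚ.* C) ℚ.* η
        ≡⟨ CCη≡ε ⟩
      ε ∎
      where open ℚₚ.≤-Reasoning

infix 7 _÷_⟨_⟩

_÷_⟨_⟩ : ℝ → (y : ℝ) → 0ℝ < y → ℝ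
x ÷ y ⟨ 0<y ⟩ = x * y ⁻¹⟨ 0<y ⟩

sum : ℕ → (ℕ → ℝ) → ℝ
sum zero    f = 0ℝ
sum (suc n) f = sum n f + f n

IsMinimum : ∀ {n} → ℝ → (Fin n → ℝ) → Set
IsMinimum x xs = (∀ i → x ≤ xs i) × ∃ λ i → xs i ≃ x

-- nothing stands for +∞
ℕ∞ : Set
ℕ∞ = Maybe ℕ

-- mass k is Pr(D = k + 1).  The masses need not sum to 1: what is missing
-- is Pr(D = +∞).
record DurationDistribution : Set where
  field
    mass        : ℕ → ℝ
    mass-nonNeg : ∀ k → 0ℝ ≤ mass k
    mass-sum≤1  : ∀ n → sum n mass ≤ 1ℝ

open DurationDistribution public

-- Pr(D > n), including D = +∞
tail : DurationDistribution → ℕ → ℝ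
tail F n = 1ℝ - sum n (mass F)

-- The expectation of g(D) for D distributed as F, where g is constant on
-- the durations exceeding n (with g(+∞) as common value).
expect : DurationDistribution → ℕ → (ℕ∞ → ℝ) → ℝ
expect F n g = sum n (λ k → mass F k * g (just (suc k))) + tail F n * g nothing

IsGeometric : DurationDistribution → ℝ → Set
IsGeometric F q =
  0ℝ ≤ q × q ≤ 1ℝ × (∀ k → mass F k ≃ (1ℝ - q) ^ k * q)

-- Resources and requests are numbered from 0.
record Instance : Set where
  field
    N              : ℕ
    T              : ℕ
    neighbours     : Fin T → Subset N
    reward         : Fin N → ℝ
    reward-nonNeg  : ∀ i → 0ℝ ≤ reward i
    reward-mono    : ∀ i j → i Fin.≤ j → reward i ≤ reward j
    duration       : Fin N → DurationDistribution

open Instance public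

Action : Instance → Set
Action I = Maybe (Fin (N I))

-- The available sets and the actions of the past periods, latest first.
History : Instance → Set
History I = List (Subset (N I) × Action I)

-- act π t h S is the action at time t after the history h when S is the set
-- of available resources.  A policy may depend arbitrarily on the instance,
-- but learns about durations only through the available sets.
record Policy (I : Instance) : Set where
  field
    act      : Fin (T I) → History I → Subset (N I) → Action I
    feasible : ∀ t h S i → act t h S ≡ just i → i ∈ neighbours I t ∩ S

open Policy public

-- The time from which each resource is available again.
State : Instance → Set
State I = Fin (N I) → ℕ∞

available : (I : Instance) → Fin (T I) → State I → Subset (N I)
available I t s = Vec.tabulate λ i → maybe′ (λ τ → τ ℕ.≤ᵇ toℕ t) false (s i)

-- ts lists the requests still to come.  A duration longer than the number of
-- requests remaining after t cannot end before the horizon, so the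
-- continuation reward is constant on such durations, as expect requires.
rewardFrom : (I : Instance) → Policy I → List (Fin (T I)) → History I → State I → ℝ
rewardFrom I π []       h s = 0ℝ
rewardFrom I π (t ∷ ts) h s =
  maybe′ (λ i → reward I i +
                expect (duration I i) (length ts)
                  (λ d → rewardFrom I π ts h′ (updateAt s i (const (Maybe.map (toℕ t ℕ.+_) d)))))
         (rewardFrom I π ts h′ s)
         a
  where
  S  = available I t s
  a  = act π t h S
  h′ = (S , a) ∷ h

expectedReward : (I : Instance) → Policy I → ℝ
expectedReward I π = rewardFrom I π (allFin (T I)) [] (λ _ → just 0)

largest : ∀ {n} → Subset n → Maybe (Fin n)
largest []      = nothing
largest (b ∷ S) with largest S
... | just i = just (Fin.suc i)
largest (true  ∷ S) | nothing = just Fin.zero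
largest (false ∷ S) | nothing = nothing

largest-∈ : ∀ {n} (S : Subset n) i → largest S ≡ just i → i ∈ S
largest-∈ (b ∷ S) i eq with largest S in eqS
largest-∈ (b     ∷ S) .(Fin.suc i) refl | just i  = there (largest-∈ S i eqS)
largest-∈ (true  ∷ S) .Fin.zero    refl | nothing = here

greedy : (I : Instance) → Policy I
greedy I = record
  { act      = λ t h S → largest (neighbours I t ∩ S)
  ; feasible = λ t h S → largest-∈ (neighbours I t ∩ S)
  }

Greedy : Instance → ℝ
Greedy I = expectedReward I (greedy I)

IsOPT : Instance → ℝ → Set
IsOPT I v =
  (∃ λ (π : Policy I) → expectedReward I π ≃ v) ×
  (∀ (π : Policy I) → expectedReward I π ≤ v)

{-# OPTIONS --safe #-}
-- Two resources of reward 1, both with Geometric(p) durations, and two requests: the first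
-- is adjacent to both resources, the second only to the one of higher index.  Greedy spends
-- the latter on the first request and serves the second only if it returns at once, earning
-- 1 + p; matching request t to resource t earns 2, the most that two requests can yield.
-- So the ratio is (1 + p) / 2 exactly.
module Submission where

open import Defs
open import Data.Bool using (true; false; if_then_else_)
open import Data.Fin using (Fin; zero; suc; toℕ)
open import Data.Fin.Subset using (_∈_; _∩_)
open import Data.List using ([]; _∷_; length; allFin)
open import Data.Maybe as Maybe using (just; nothing)
open import Data.Nat as ℕ using (ℕ; zero; suc)
import Data.Nat.Properties as ℕₚ
open import Data.Product using (Σ; ∃; _×_; _,_)
open import Data.Rational as ℚ using (ℚ; 0ℚ; 1ℚ; ½)
import Data.Rational.Properties as ℚₚ
open import Data.Rational.Solver using (module +-*-Solver)
open import Data.Sum using (inj₁; inj₂)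
open import Data.Vec using ([]; _∷_; lookup)
open import Data.Vec.Properties using (lookup⇒[]=)
open import Data.Vec.Functional using (updateAt)
open import Function using (const)
open import Relation.Binary.PropositionalEquality using (_≡_; refl; sym; trans; cong; cong₂; subst; subst₂)

open +-*-Solver using (solve; con; _:=_; _:+_; _:-_; _:*_)

-- Termwise equality of representatives

infix 4 _≗_

-- Finer than `_≃_`: identities between reals reduce to rational ring identities at each index, with
-- no ε involved.
_≗_ : ℝ → ℝ → Set
x ≗ y = ∀ n → seq x n ≡ seq y n

opaque
  unfolding _+_ -_ _*_

  -- Definitional once unfolded; these equations let later proofs compute with terms while the
  -- operations stay opaque.
  seq-+ : ∀ x y n → seq (x + y) n ≡ seq x n ℚ.+ seq y n
  seq-+ x y n = refl

  seq-- : ∀ x y n → seq (x - y) n ≡ seq x n ℚ.- seq y n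
  seq-- x y n = refl

  seq-* : ∀ x y n → seq (x * y) n ≡ seq x n ℚ.* seq y n
  seq-* x y n = refl

2ℚ : ℚ
2ℚ = 1ℚ ℚ.+ 1ℚ

0<2 : 0ℝ < fromℚ 2ℚ
0<2 = 2ℚ , ℚₚ.positive⁻¹ 2ℚ , 0 , λ _ _ → ℚₚ.≤-refl

opaque
  unfolding _+_ _⁻¹⟨_⟩

  1+1≗2 : sum 2 (λ _ → 1ℝ) ≗ fromℚ 2ℚ
  1+1≗2 n = refl

  -- The witness in `0<2` is the closed rational 2, so the clamping inside the inverse computes.
  seq-2⁻¹ : ∀ n → seq (fromℚ 2ℚ ⁻¹⟨ 0<2 ⟩) n ≡ ½
  seq-2⁻¹ n = refl

≗⇒≃ : ∀ x y → x ≗ y → x ≃ y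
≗⇒≃ x y x≗y ε 0<ε = 0 , λ n _ → subst (ℚ._≤ ε)
  (cong ℚ.∣_∣ (sym (trans (cong (ℚ._- seq y n) (x≗y n)) (ℚₚ.+-inverseʳ (seq y n)))))
  (ℚₚ.<⇒≤ 0<ε)

≤-respˡ-≗ : ∀ x x′ y → x ≗ x′ → x ≤ y → x′ ≤ y
≤-respˡ-≗ x x′ y x≗x′ x≤y ε 0<ε with x≤y ε 0<ε
... | M , h = M , λ n p → subst (ℚ._≤ seq y n ℚ.+ ε) (x≗x′ n) (h n p)

≤-respʳ-≗ : ∀ x y y′ → y ≗ y′ → x ≤ y → x ≤ y′
≤-respʳ-≗ x y y′ y≗y′ x≤y ε 0<ε with x≤y ε 0<ε
... | M , h = M , λ n p → subst (λ b → seq x n ℚ.≤ b ℚ.+ ε) (y≗y′ n) (h n p)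

-- The order on ℝ

p-q+q≡p : ∀ p q → (p ℚ.- q) ℚ.+ q ≡ p
p-q+q≡p = solve 2 (λ p q → (p :- q) :+ q := p) refl

p≤p+q : ∀ p {q} → 0ℚ ℚ.≤ q → p ℚ.≤ p ℚ.+ q
p≤p+q p {q} 0≤q = subst (ℚ._≤ p ℚ.+ q) (ℚₚ.+-identityʳ p) (ℚₚ.+-monoʳ-≤ p 0≤q)

*-pos : ∀ {p q} → 0ℚ ℚ.< p → 0ℚ ℚ.< q → 0ℚ ℚ.< p ℚ.* q
*-pos {p} {q} 0<p 0<q = ℚₚ.positive⁻¹ (p ℚ.* q)
  {{ℚₚ.pos*pos⇒pos p {{ℚ.positive 0<p}} q {{ℚ.positive 0<q}}}}

≤-refl : ∀ x → x ≤ x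
≤-refl x ε 0<ε = 0 , λ n _ → p≤p+q (seq x n) (ℚₚ.<⇒≤ 0<ε)

0≤1 : 0ℝ ≤ 1ℝ
0≤1 ε 0<ε = 0 , λ n _ → ℚₚ.≤-trans (ℚₚ.<⇒≤ (ℚₚ.positive⁻¹ 1ℚ)) (p≤p+q 1ℚ (ℚₚ.<⇒≤ 0<ε))

+-mono-≤ : ∀ x y u v → x ≤ y → u ≤ v → x + u ≤ y + v
+-mono-≤ x y u v x≤y u≤v ε 0<ε
  with x≤y (½ ℚ.* ε) (*-pos (ℚₚ.positive⁻¹ ½) 0<ε) | u≤v (½ ℚ.* ε) (*-pos (ℚₚ.positive⁻¹ ½) 0<ε)
... | M , h | K , k = M ℕ.⊔ K , λ n p → subst₂ ℚ._≤_
  (sym (seq-+ x u n))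
  (trans (regroup (seq y n) (seq v n) ε) (cong (ℚ._+ ε) (sym (seq-+ y v n))))
  (ℚₚ.+-mono-≤ (h n (ℕₚ.m⊔n≤o⇒m≤o M K p)) (k n (ℕₚ.m⊔n≤o⇒n≤o M K p)))
  where
  regroup : ∀ a b ε → (a ℚ.+ ½ ℚ.* ε) ℚ.+ (b ℚ.+ ½ ℚ.* ε) ≡ (a ℚ.+ b) ℚ.+ ε
  -- The solver sees ½ as a variable `h`; afterwards ½ + ½ computes to 1.
  regroup a b ε = trans (shuffle a b ½ ε)
    (cong ((a ℚ.+ b) ℚ.+_) (ℚₚ.*-identityˡ ε))
    where
    shuffle : ∀ a b h ε → (a ℚ.+ h ℚ.* ε) ℚ.+ (b ℚ.+ h ℚ.* ε) ≡ (a ℚ.+ b) ℚ.+ (h ℚ.+ h) ℚ.* ε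
    shuffle = solve 4 (λ a b h ε →
      (a :+ h :* ε) :+ (b :+ h :* ε) := (a :+ b) :+ (h :+ h) :* ε) refl

+-nonNeg : ∀ x y → 0ℝ ≤ x → 0ℝ ≤ y → 0ℝ ≤ x + y
+-nonNeg x y 0≤x 0≤y =
  ≤-respˡ-≗ (0ℝ + 0ℝ) 0ℝ (x + y) (seq-+ 0ℝ 0ℝ) (+-mono-≤ 0ℝ x 0ℝ y 0≤x 0≤y)

-- With its converse below, this turns bounds on sums of masses and on expectations into
-- nonnegativity, which sums and products preserve.
x≤y⇒0≤y-x : ∀ x y → x ≤ y → 0ℝ ≤ y - x
x≤y⇒0≤y-x x y x≤y = ≤-respˡ-≗ (x - x) 0ℝ (y - x)
  (λ n → trans (seq-- x x n) (ℚₚ.+-inverseʳ (seq x n)))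
  (+-mono-≤ x y (- x) (- x) x≤y (≤-refl (- x)))

0≤y-x⇒x≤y : ∀ x y → 0ℝ ≤ y - x → x ≤ y
0≤y-x⇒x≤y x y 0≤y-x =
  ≤-respˡ-≗ (0ℝ + x) x y
    (λ n → trans (seq-+ 0ℝ x n) (ℚₚ.+-identityˡ (seq x n)))
    (≤-respʳ-≗ (0ℝ + x) (y - x + x) y
      (λ n → trans (seq-+ (y - x) x n)
        (trans (cong (ℚ._+ seq x n) (seq-- y x n)) (p-q+q≡p (seq y n) (seq x n))))
      (+-mono-≤ 0ℝ (y - x) x x 0≤y-x (≤-refl x)))

x≤y⇒x≤y+z : ∀ x y z → x ≤ y → 0ℝ ≤ z → x ≤ y + z
x≤y⇒x≤y+z x y z x≤y 0≤z = ≤-respˡ-≗ (x + 0ℝ) x (y + z)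
  (λ n → trans (seq-+ x 0ℝ n) (ℚₚ.+-identityʳ (seq x n)))
  (+-mono-≤ x y 0ℝ z x≤y 0≤z)

0<x⇒0≤x : ∀ x → 0ℝ < x → 0ℝ ≤ x
0<x⇒0≤x x (δ , 0<δ , M , h) ε 0<ε = M , λ n p →
  ℚₚ.≤-trans (subst (0ℚ ℚ.≤_) (sym (ℚₚ.+-identityˡ δ)) (ℚₚ.<⇒≤ 0<δ))
    (ℚₚ.≤-trans (h n p) (p≤p+q (seq x n) (ℚₚ.<⇒≤ 0<ε)))

-- Products of nonnegative reals

p≤∣p∣ : ∀ p → p ℚ.≤ ℚ.∣ p ∣
p≤∣p∣ p with ℚₚ.≤-total 0ℚ p
... | inj₁ 0≤p = ℚₚ.≤-reflexive (sym (ℚₚ.0≤p⇒∣p∣≡p 0≤p))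
... | inj₂ p≤0 = ℚₚ.≤-trans p≤0 (ℚₚ.0≤∣p∣ p)

eventuallyBelow : ∀ x → ∃ λ B → 0ℚ ℚ.< B × ∃ λ M → ∀ n → M ℕ.≤ n → seq x n ℚ.≤ B
eventuallyBelow x with cauchy x 1ℚ (ℚₚ.positive⁻¹ 1ℚ)
... | M , h = 1ℚ ℚ.+ ℚ.∣ seq x M ∣ ,
  ℚₚ.+-mono-<-≤ (ℚₚ.positive⁻¹ 1ℚ) (ℚₚ.0≤∣p∣ (seq x M)) ,
  M , λ n p → subst (ℚ._≤ 1ℚ ℚ.+ ℚ.∣ seq x M ∣) (p-q+q≡p (seq x n) (seq x M))
    (ℚₚ.+-mono-≤ (ℚₚ.≤-trans (p≤∣p∣ (seq x n ℚ.- seq x M)) (h n M p ℕₚ.≤-refl)) (p≤∣p∣ (seq x M)))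

-- Take δ = min(ε/C, 1). The cap at 1 lets a stray δ be absorbed into a constant fixed beforehand.
smallFactor : ∀ {ε C} → 0ℚ ℚ.< ε → 0ℚ ℚ.< C → ∃ λ δ → 0ℚ ℚ.< δ × δ ℚ.≤ 1ℚ × δ ℚ.* C ℚ.≤ ε
smallFactor {ε} {C} 0<ε 0<C = δ , 0<δ , ℚₚ.p⊓q≤q r 1ℚ , δC≤ε
  where
  instance
    _ = ℚ.positive 0<C
    _ = ℚₚ.pos⇒nonZero C
    _ = ℚₚ.pos⇒nonNeg C
  r = ε ℚ.* (ℚ.1/ C)
  δ = r ℚ.⊓ 1ℚ
  0<δ : 0ℚ ℚ.< δ
  0<δ with ℚₚ.⊓-sel r 1ℚ
  ... | inj₁ eq = subst (0ℚ ℚ.<_) (sym eq)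
                    (*-pos 0<ε (ℚₚ.positive⁻¹ (ℚ.1/ C) {{ℚₚ.1/pos⇒pos C}}))
  ... | inj₂ eq = subst (0ℚ ℚ.<_) (sym eq) (ℚₚ.positive⁻¹ 1ℚ)
  δC≤ε : δ ℚ.* C ℚ.≤ ε
  δC≤ε = subst (δ ℚ.* C ℚ.≤_)
    (trans (ℚₚ.*-assoc ε (ℚ.1/ C) C)
      (trans (cong (ε ℚ.*_) (ℚₚ.*-inverseˡ C)) (ℚₚ.*-identityʳ ε)))
    (ℚₚ.*-monoʳ-≤-nonNeg C (ℚₚ.p⊓q≤p r 1ℚ))

-- If a, b ≥ -δ then 0 ≤ (a + δ)(b + δ) = ab + δ(a + b + δ).
*-almostNonNeg : ∀ a b A B δ ε → 0ℚ ℚ.≤ a ℚ.+ δ → 0ℚ ℚ.≤ b ℚ.+ δ → a ℚ.≤ A → b ℚ.≤ B →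
  0ℚ ℚ.≤ δ → δ ℚ.≤ 1ℚ → δ ℚ.* (A ℚ.+ B ℚ.+ 1ℚ) ℚ.≤ ε → 0ℚ ℚ.≤ a ℚ.* b ℚ.+ ε
*-almostNonNeg a b A B δ ε 0≤a+δ 0≤b+δ a≤A b≤B 0≤δ δ≤1 δC≤ε = begin
  0ℚ
    ≤⟨ ℚₚ.nonNegative⁻¹ ((a ℚ.+ δ) ℚ.* (b ℚ.+ δ)) {{ℚₚ.nonNeg*nonNeg⇒nonNeg
         (a ℚ.+ δ) {{ℚ.nonNegative 0≤a+δ}} (b ℚ.+ δ) {{ℚ.nonNegative 0≤b+δ}}}} ⟩
  (a ℚ.+ δ) ℚ.* (b ℚ.+ δ)
    ≡⟨ expand a b δ ⟩
  a ℚ.* b ℚ.+ δ ℚ.* (a ℚ.+ b ℚ.+ δ)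
    ≤⟨ ℚₚ.+-monoʳ-≤ (a ℚ.* b) (ℚₚ.*-monoˡ-≤-nonNeg δ {{ℚ.nonNegative 0≤δ}}
         (ℚₚ.+-mono-≤ (ℚₚ.+-mono-≤ a≤A b≤B) δ≤1)) ⟩
  a ℚ.* b ℚ.+ δ ℚ.* (A ℚ.+ B ℚ.+ 1ℚ)
    ≤⟨ ℚₚ.+-monoʳ-≤ (a ℚ.* b) δC≤ε ⟩
  a ℚ.* b ℚ.+ ε ∎
  where
  open ℚₚ.≤-Reasoning
  expand : ∀ a b δ → (a ℚ.+ δ) ℚ.* (b ℚ.+ δ) ≡ a ℚ.* b ℚ.+ δ ℚ.* (a ℚ.+ b ℚ.+ δ)
  expand = solve 3 (λ a b δ → (a :+ δ) :* (b :+ δ) := a :* b :+ δ :* (a :+ b :+ δ)) refl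

-- A nonnegative real may have negative terms, but eventually none below -δ. With eventual upper
-- bounds A and B, the constant A + B + 1 dominates a + b + δ, so a small δ keeps the product above
-- -ε.
*-nonNeg : ∀ x y → 0ℝ ≤ x → 0ℝ ≤ y → 0ℝ ≤ x * y
*-nonNeg x y 0≤x 0≤y ε 0<ε =
  let A , 0<A , M₁ , x≤A = eventuallyBelow x
      B , 0<B , M₂ , y≤B = eventuallyBelow y
      δ , 0<δ , δ≤1 , δC≤ε = smallFactor {ε} {A ℚ.+ B ℚ.+ 1ℚ} 0<ε
        (ℚₚ.+-mono-< (ℚₚ.+-mono-< 0<A 0<B) (ℚₚ.positive⁻¹ 1ℚ))
      M₃ , x≥ = 0≤x δ 0<δ
      M₄ , y≥ = 0≤y δ 0<δ
  in (M₁ ℕ.⊔ M₂) ℕ.⊔ (M₃ ℕ.⊔ M₄) , λ n p →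
  let p₁₂ = ℕₚ.m⊔n≤o⇒m≤o (M₁ ℕ.⊔ M₂) (M₃ ℕ.⊔ M₄) p
      p₃₄ = ℕₚ.m⊔n≤o⇒n≤o (M₁ ℕ.⊔ M₂) (M₃ ℕ.⊔ M₄) p
  in subst (λ a → 0ℚ ℚ.≤ a ℚ.+ ε) (sym (seq-* x y n))
       (*-almostNonNeg (seq x n) (seq y n) A B δ ε
         (x≥ n (ℕₚ.m⊔n≤o⇒m≤o M₃ M₄ p₃₄)) (y≥ n (ℕₚ.m⊔n≤o⇒n≤o M₃ M₄ p₃₄))
         (x≤A n (ℕₚ.m⊔n≤o⇒m≤o M₁ M₂ p₁₂)) (y≤B n (ℕₚ.m⊔n≤o⇒n≤o M₁ M₂ p₁₂))
         (ℚₚ.<⇒≤ 0<δ) δ≤1 δC≤ε)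

^-nonNeg : ∀ x → 0ℝ ≤ x → ∀ k → 0ℝ ≤ x ^ k
^-nonNeg x 0≤x zero    = 0≤1
^-nonNeg x 0≤x (suc k) = *-nonNeg x (x ^ k) 0≤x (^-nonNeg x 0≤x k)

sum-nonNeg : ∀ n f → (∀ k → 0ℝ ≤ f k) → 0ℝ ≤ sum n f
sum-nonNeg zero    f 0≤f = ≤-refl 0ℝ
sum-nonNeg (suc n) f 0≤f = +-nonNeg (sum n f) (f n) (sum-nonNeg n f 0≤f) (0≤f n)

-- Geometric durations

opaque
  unfolding _+_ -_ _*_

  -- Induction: removing the mass (1 - p)^n p from the tail (1 - p)^n leaves (1 - p)^(n+1). The tail
  -- is thus a power of 1 - p, which bounds the total mass by 1.
  geometric-sum : ∀ p n → 1ℝ - sum n (λ k → (1ℝ - p) ^ k * p) ≗ (1ℝ - p) ^ n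
  geometric-sum p zero    m = refl
  geometric-sum p (suc n) m = trans
    (step₁ (seq (sum n (λ k → (1ℝ - p) ^ k * p)) m) (seq ((1ℝ - p) ^ n) m) (seq p m))
    (trans (cong (ℚ._- seq ((1ℝ - p) ^ n) m ℚ.* seq p m) (geometric-sum p n m))
           (step₂ (seq ((1ℝ - p) ^ n) m) (seq p m)))
    where
    step₁ : ∀ s x q → 1ℚ ℚ.- (s ℚ.+ x ℚ.* q) ≡ (1ℚ ℚ.- s) ℚ.- x ℚ.* q
    step₁ = solve 3 (λ s x q → con 1ℚ :- (s :+ x :* q) := (con 1ℚ :- s) :- x :* q) refl
    step₂ : ∀ x q → x ℚ.- x ℚ.* q ≡ (1ℚ ℚ.- q) ℚ.* x
    step₂ = solve 2 (λ x q → x :- x :* q := (con 1ℚ :- q) :* x) refl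

geometric : (p : ℝ) → 0ℝ ≤ p → p ≤ 1ℝ → DurationDistribution
geometric p 0≤p p≤1 = record
  { mass        = μ
  ; mass-nonNeg = λ k → *-nonNeg ((1ℝ - p) ^ k) p (^-nonNeg (1ℝ - p) 0≤1-p k) 0≤p
  ; mass-sum≤1  = λ n → 0≤y-x⇒x≤y (sum n μ) 1ℝ
      (≤-respʳ-≗ 0ℝ ((1ℝ - p) ^ n) (1ℝ - sum n μ)
        (λ m → sym (geometric-sum p n m)) (^-nonNeg (1ℝ - p) 0≤1-p n))
  }
  where
  μ : ℕ → ℝ
  μ k = (1ℝ - p) ^ k * p
  0≤1-p : 0ℝ ≤ 1ℝ - p
  0≤1-p = x≤y⇒0≤y-x p 1ℝ p≤1

geometric-isGeometric : ∀ p (0≤p : 0ℝ ≤ p) (p≤1 : p ≤ 1ℝ) → IsGeometric (geometric p 0≤p p≤1) p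
geometric-isGeometric p 0≤p p≤1 = 0≤p , p≤1 , λ k →
  ≗⇒≃ ((1ℝ - p) ^ k * p) ((1ℝ - p) ^ k * p) λ _ → refl

-- An upper bound on the expected reward

opaque
  unfolding _+_ -_ _*_

  -- As the masses and the tail add up to 1, the gap to c is the expectation of the gaps.
  expect-gap : ∀ F n g c →
    expect F n (λ d → c - g d) ≗ c - expect F n g
  expect-gap F n g c m = trans
    (cong (ℚ._+ (1ℚ ℚ.- μ) ℚ.* (seq c m ℚ.- γ)) (sum-gap n))
    (regroup μ (seq c m) (seq (sum n (λ k → mass F k * g (just (suc k)))) m) γ)
    where
    μ γ : ℚ
    μ = seq (sum n (mass F)) m
    γ = seq (g nothing) m
    distrib : ∀ s c e a b → (s ℚ.* c ℚ.- e) ℚ.+ a ℚ.* (c ℚ.- b) ≡ (s ℚ.+ a) ℚ.* c ℚ.- (e ℚ.+ a ℚ.* b)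
    distrib = solve 5 (λ s c e a b →
      (s :* c :- e) :+ a :* (c :- b) := (s :+ a) :* c :- (e :+ a :* b)) refl
    regroup : ∀ s c e b → (s ℚ.* c ℚ.- e) ℚ.+ (1ℚ ℚ.- s) ℚ.* (c ℚ.- b) ≡ c ℚ.- (e ℚ.+ (1ℚ ℚ.- s) ℚ.* b)
    regroup = solve 4 (λ s c e b →
      (s :* c :- e) :+ (con 1ℚ :- s) :* (c :- b) := c :- (e :+ (con 1ℚ :- s) :* b)) refl
    sum-gap : ∀ n → seq (sum n (λ k → mass F k * (c - g (just (suc k))))) m ≡
      seq (sum n (mass F)) m ℚ.* seq c m ℚ.- seq (sum n (λ k → mass F k * g (just (suc k)))) m
    sum-gap zero    = solve 1 (λ c → con 0ℚ := con 0ℚ :* c :- con 0ℚ) refl (seq c m)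
    sum-gap (suc n) = trans
      (cong (ℚ._+ seq (mass F n) m ℚ.* (seq c m ℚ.- seq (g (just (suc n))) m)) (sum-gap n))
      (distrib (seq (sum n (mass F)) m) (seq c m) (seq (sum n (λ k → mass F k * g (just (suc k)))) m)
         (seq (mass F n) m) (seq (g (just (suc n))) m))

-- By `expect-gap` the difference is a sum of nonnegative gaps weighted by the masses and the tail.
expect-≤ : ∀ F n g c → (∀ d → g d ≤ c) → expect F n g ≤ c
expect-≤ F n g c g≤c = 0≤y-x⇒x≤y (expect F n g) c
  (≤-respʳ-≗ 0ℝ (expect F n (λ d → c - g d)) (c - expect F n g) (expect-gap F n g c)
    (+-nonNeg (sum n gaps) (tail F n * (c - g nothing))
      (sum-nonNeg n gaps λ k → *-nonNeg (mass F k) (c - g (just (suc k)))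
        (mass-nonNeg F k) (0≤gap (just (suc k))))
      (*-nonNeg (tail F n) (c - g nothing)
        (x≤y⇒0≤y-x (sum n (mass F)) 1ℝ (mass-sum≤1 F n)) (0≤gap nothing))))
  where
  gaps : ℕ → ℝ
  gaps k = mass F k * (c - g (just (suc k)))
  0≤gap : ∀ d → 0ℝ ≤ c - g d
  0≤gap d = x≤y⇒0≤y-x (g d) c (g≤c d)

+-comm : ∀ x y → x + y ≗ y + x
+-comm x y n = trans (seq-+ x y n) (trans (ℚₚ.+-comm (seq x n) (seq y n)) (sym (seq-+ y x n)))

-- Induction on the requests to come: the present one yields at most c, and the bound on the rest
-- holds for every duration, hence in expectation.
rewardFrom-≤ : ∀ I π c → 0ℝ ≤ c → (∀ i → reward I i ≤ c) →
  ∀ ts h s → rewardFrom I π ts h s ≤ sum (length ts) (λ _ → c)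
rewardFrom-≤ I π c 0≤c r≤c []       h s = ≤-refl 0ℝ
rewardFrom-≤ I π c 0≤c r≤c (t ∷ ts) h s with act π t h (available I t s)
... | nothing = x≤y⇒x≤y+z (rewardFrom I π ts h′ s) (sum (length ts) (λ _ → c)) c
  (rewardFrom-≤ I π c 0≤c r≤c ts h′ s) 0≤c
  where h′ = (available I t s , nothing) ∷ h
... | just i  =
  -- `rewardFrom` adds the present reward on the left, `sum` its last term on the right.
  ≤-respʳ-≗ (reward I i + future) (c + rest) (rest + c) (+-comm c rest)
    (+-mono-≤ (reward I i) c future rest (r≤c i)
      (expect-≤ (duration I i) (length ts) continue rest
        λ d → rewardFrom-≤ I π c 0≤c r≤c ts h′ (next d)))
  where
  h′ = (available I t s , just i) ∷ h
  next : ℕ∞ → State I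
  next d = updateAt s i (const (Maybe.map (toℕ t ℕ.+_) d))
  continue : ℕ∞ → ℝ
  continue d = rewardFrom I π ts h′ (next d)
  future = expect (duration I i) (length ts) continue
  rest = sum (length ts) (λ _ → c)

-- The instance

twoRequests : (p : ℝ) → 0ℝ ≤ p → p ≤ 1ℝ → Instance
twoRequests p 0≤p p≤1 = record
  { N             = 2
  ; T             = 2
  ; neighbours    = λ { zero → true ∷ true ∷ [] ; (suc _) → false ∷ true ∷ [] }
  ; reward        = λ _ → 1ℝ
  ; reward-nonNeg = λ _ → 0≤1
  ; reward-mono   = λ _ _ _ → ≤-refl 1ℝ
  ; duration      = λ _ → geometric p 0≤p p≤1
  }

-- Values of the two policies and the optimum

module _ (p : ℝ) (0≤p : 0ℝ ≤ p) (p≤1 : p ≤ 1ℝ) where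

  private
    I = twoRequests p 0≤p p≤1

  -- Requests and resources share the index type `Fin 2`. The test is there because feasibility is
  -- demanded for every set `S`, even one that never arises.
  diagonal : Policy I
  diagonal = record
    { act      = λ t h S → if lookup (neighbours I t ∩ S) t then just t else nothing
    ; feasible = diagonal-feasible
    }
    where
    diagonal-feasible : ∀ t (h : History I) S i →
      (if lookup (neighbours I t ∩ S) t then just t else nothing) ≡ just i → i ∈ neighbours I t ∩ S
    diagonal-feasible t h S i eq with lookup (neighbours I t ∩ S) t in t∈
    diagonal-feasible t h S .t refl | true = lookup⇒[]= t (neighbours I t ∩ S) t∈

  opaque
    unfolding _+_ -_ _*_

    Greedy≗1+p : Greedy I ≗ 1ℝ + p
    Greedy≗1+p n = simplify (seq p n)
      where
      -- What evaluation leaves: 1 for the first match, then 1 with weight (1 - q)^0 q, the case D =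
      -- 1, and 0 with the tail weight.
      simplify : ∀ q →
        1ℚ ℚ.+ ((0ℚ ℚ.+ (1ℚ ℚ.* q) ℚ.* 1ℚ) ℚ.+ (1ℚ ℚ.- (0ℚ ℚ.+ 1ℚ ℚ.* q)) ℚ.* 0ℚ) ≡ 1ℚ ℚ.+ q
      simplify = solve 1 (λ q →
        con 1ℚ :+ ((con 0ℚ :+ (con 1ℚ :* q) :* con 1ℚ) :+
                   (con 1ℚ :- (con 0ℚ :+ con 1ℚ :* q)) :* con 0ℚ) := con 1ℚ :+ q) refl

    diagonal≗2 : expectedReward I diagonal ≗ fromℚ 2ℚ
    diagonal≗2 n = simplify (seq p n)
      where
      -- Now both branches carry 1, since the second match does not wait for the first resource.
      simplify : ∀ q →
        1ℚ ℚ.+ ((0ℚ ℚ.+ (1ℚ ℚ.* q) ℚ.* 1ℚ) ℚ.+ (1ℚ ℚ.- (0ℚ ℚ.+ 1ℚ ℚ.* q)) ℚ.* 1ℚ) ≡ 2ℚ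
      simplify = solve 1 (λ q →
        con 1ℚ :+ ((con 0ℚ :+ (con 1ℚ :* q) :* con 1ℚ) :+
                   (con 1ℚ :- (con 0ℚ :+ con 1ℚ :* q)) :* con 1ℚ) := con 2ℚ) refl

  2-isOPT : IsOPT I (fromℚ 2ℚ)
  2-isOPT = (diagonal , ≗⇒≃ (expectedReward I diagonal) (fromℚ 2ℚ) diagonal≗2) , λ π →
    ≤-respʳ-≗ (expectedReward I π) (sum 2 (λ _ → 1ℝ)) (fromℚ 2ℚ) 1+1≗2
      (rewardFrom-≤ I π 1ℝ 0≤1 (λ _ → ≤-refl 1ℝ) (allFin 2) [] (λ _ → just 0))

mainTheorem3 : (p : ℝ) → 0ℝ ≤ p → p ≤ 1ℝ → (ε : ℝ) → 0ℝ < ε →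
    Σ Instance λ I → Σ (Fin (N I) → ℝ) λ ps →
    (∀ i → IsGeometric (duration I i) (ps i)) ×
    IsMinimum p ps ×
    Σ ℝ λ OPT → IsOPT I OPT ×
    Σ (0ℝ < OPT) λ OPT>0 →
    Greedy I ÷ OPT ⟨ OPT>0 ⟩ ≤ (1ℝ + p) * ½ℝ + ε
mainTheorem3 p 0≤p p≤1 ε 0<ε =
  I , (λ _ → p) ,
  (λ _ → geometric-isGeometric p 0≤p p≤1) ,
  ((λ _ → ≤-refl p) , zero , ≗⇒≃ p p (λ _ → refl)) ,
  fromℚ 2ℚ , 2-isOPT p 0≤p p≤1 , 0<2 ,
  -- The ratio equals (1 + p)/2 termwise; ε is then added as a nonnegative summand.
  x≤y⇒x≤y+z ratio ((1ℝ + p) * ½ℝ) ε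
    (≤-respʳ-≗ ratio ratio ((1ℝ + p) * ½ℝ) ratio≗ (≤-refl ratio)) (0<x⇒0≤x ε 0<ε)
  where
  I = twoRequests p 0≤p p≤1
  ratio = Greedy I ÷ fromℚ 2ℚ ⟨ 0<2 ⟩
  ratio≗ : ratio ≗ (1ℝ + p) * ½ℝ
  ratio≗ n = trans (seq-* (Greedy I) (fromℚ 2ℚ ⁻¹⟨ 0<2 ⟩) n)
    (trans (cong₂ ℚ._*_ (Greedy≗1+p p 0≤p p≤1 n) (seq-2⁻¹ n)) (sym (seq-* (1ℝ + p) ½ℝ n)))
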